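{- For all integers $m,n\ge 0$ and $k\ge 1$, the polynomial $$\left[{m+n\atop m}\right]^{\mathrm{c}k}_q:=\mathrm{CT}_z\left[(-qz;q)_m^k(-z^{ -1};q)_n^k\right]$$ is unimodal, i.e. its sequence of coefficients $(a_0,a_1,\dots,a_D)$ (where $D$ is its degree in $q$) first weakly increases and then weakly decreases.
   Context: $(a;q)_n=\prod_{0\le j<n}(1-aq^j)$. For a Laurent polynomial $f(z)$ in $z$ (with coefficients polynomials in $q$), $\mathrm{CT}_z[f(z)]$ denotes its constant term in $z$. These are Andrews's generalized Gauss polynomials of the second kind. -}

module Defs where

open import Data.Nat using (ℕ; zero; suc; _∸_; _⊔_; _<_; _≤_) renaming (_+_ to _+ℕ_)
open import Data.Integer using (ℤ; +_; -_; _+_; _*_) renaming (_≤_ to _≤ℤ_)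
open import Data.Integer.Properties using () renaming (_≟_ to _≟ℤ_)
open import Data.List using (List; []; _∷_; map; replicate; _++_; reverse; length)
open import Data.Product using (∃; _×_)
open import Relation.Nullary using (yes; no)

-- Polynomials in q with integer coefficients:
-- a list  a₀ ∷ a₁ ∷ … ∷ []  represents  a₀ + a₁ q + a₂ q² + …

Poly : Set
Poly = List ℤ

addP : Poly → Poly → Poly
addP []       q        = q
addP (a ∷ p)  []       = a ∷ p
addP (a ∷ p)  (b ∷ q)  = (a + b) ∷ addP p q

scaleP : ℤ → Poly → Poly
scaleP c p = map (c *_) p

mulP : Poly → Poly → Poly
mulP []       q = []
mulP (a ∷ p)  q = addP (scaleP a q) ((+ 0) ∷ mulP p q)

qPow : ℕ → Poly
qPow j = replicate j (+ 0) ++ ((+ 1) ∷ [])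

coeff : Poly → ℕ → ℤ
coeff []       i       = + 0
coeff (a ∷ p)  zero    = a
coeff (a ∷ p)  (suc i) = coeff p i

dropZeros : List ℤ → List ℤ
dropZeros []      = []
dropZeros (a ∷ p) with a ≟ℤ + 0
... | yes _ = dropZeros p
... | no  _ = a ∷ p

trim : Poly → Poly
trim p = reverse (dropZeros (reverse p))

-- degree in q (degree of the zero polynomial taken to be 0)
degree : Poly → ℕ
degree p = length (trim p) ∸ 1

Unimodal : Poly → Set
Unimodal p =
  ∃ λ t → (t ≤ degree p)
        × (∀ i → i < t → coeff p i ≤ℤ coeff p (suc i))
        × (∀ i → t ≤ i → i < degree p → coeff p (suc i) ≤ℤ coeff p i)

-- Laurent polynomials in z with coefficients in Poly:
-- lz s (c₀ ∷ c₁ ∷ …)  represents  Σ_i c_i z^(i - s)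

record Laurent : Set where
  constructor lz
  field
    low : ℕ
    cs  : List Poly

addL' : List Poly → List Poly → List Poly
addL' []       q        = q
addL' (a ∷ p)  []       = a ∷ p
addL' (a ∷ p)  (b ∷ q)  = addP a b ∷ addL' p q

mulL' : List Poly → List Poly → List Poly
mulL' []       q = []
mulL' (a ∷ p)  q = addL' (map (mulP a) q) ([] ∷ mulL' p q)

_⊕_ : Laurent → Laurent → Laurent
lz a p ⊕ lz b q =
  lz (a ⊔ b) (addL' (replicate ((a ⊔ b) ∸ a) [] ++ p)
                    (replicate ((a ⊔ b) ∸ b) [] ++ q))

_⊗_ : Laurent → Laurent → Laurent
lz a p ⊗ lz b q = lz (a +ℕ b) (mulL' p q)

negL : Laurent → Laurent
negL (lz a p) = lz a (map (scaleP (- (+ 1))) p)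

constL : Poly → Laurent
constL c = lz 0 (c ∷ [])

oneL : Laurent
oneL = constL ((+ 1) ∷ [])

_^L_ : Laurent → ℕ → Laurent
x ^L zero  = oneL
x ^L suc k = x ⊗ (x ^L k)

nth : List Poly → ℕ → Poly
nth []       i       = []
nth (c ∷ cs) zero    = c
nth (c ∷ cs) (suc i) = nth cs i

CT : Laurent → Poly
CT (lz s cs) = nth cs s

poch : Laurent → ℕ → Laurent
poch a zero    = oneL
poch a (suc n) = poch a n ⊗ (oneL ⊕ negL (a ⊗ constL (qPow n)))

-qz : Laurent
-qz = lz 0 ([] ∷ ((+ 0) ∷ (- (+ 1)) ∷ []) ∷ [])

-z⁻¹ : Laurent
-z⁻¹ = lz 1 (((- (+ 1)) ∷ []) ∷ [])

gaussC : ℕ → ℕ → ℕ → Poly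
gaussC m n k = CT ((poch -qz m ^L k) ⊗ (poch -z⁻¹ n ^L k))

{-# OPTIONS --safe #-}
module Submission where

-- Up to a power of z, the product is ∏ (q^a + z q^b) over k chains of m + n
-- sites, where b - a increases by 1 along each chain. Hence the coefficient of
-- q^w counts bit strings of a fixed size (number of ones) and of weight w.
-- Moving a one to the next site of its chain raises the weight by 1. With
-- suitable coefficients the sums U and D of the forward and backward moves
-- satisfy [D, U] = c - 2w on strings of weight w: this is sl₂ acting on an
-- exterior power of a sum of k copies of its irreducible module of dimension
-- m + n. So U is injective on weight w when c - 2w > 0, and D when c - 2w < 0,
-- and comparing dimensions gives unimodality.

open import Defs
open import Data.Nat as ℕ using (ℕ; zero; suc; _≤_)
import Data.Nat.Properties as ℕ
open import Data.Integer as ℤ using (ℤ; +_; -[1+_]; -_; _+_; _*_; _-_; _<_; 0ℤ; +<+; -<+; +≤+)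
open import Data.Integer.Properties
open import Data.Integer.Tactic.RingSolver using (solve-∀)
open import Data.Bool using (Bool; true; false; not; if_then_else_)
import Data.Bool.Properties as Bool
open import Data.Fin using (Fin; zero; suc; punchIn)
open import Data.Fin.Properties using (any?; punchIn-injective; punchInᵢ≢i)
open import Data.List using (List; []; _∷_; length; lookup; map; _++_)
open import Data.List.Properties using (length-++; length-map)
open import Data.List.Membership.Propositional using (_∈_; _∉_)
open import Data.List.Membership.Propositional.Properties using (∈-lookup; ∈-++⁺ˡ; ∈-++⁺ʳ; ∈-++⁻; ∈-map⁺; ∈-map⁻)
open import Data.List.Relation.Unary.Any using (here; index)
open import Data.List.Relation.Unary.Any.Properties using (lookup-index)
import Data.List.Relation.Unary.All as All
open import Data.List.Relation.Unary.AllPairs using ([]; _∷_)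
open import Data.List.Relation.Unary.Unique.Propositional using (Unique)
import Data.List.Relation.Unary.Unique.Propositional.Properties as Unique
open import Data.Product using (∃; _×_; _,_; proj₁; proj₂)
open import Data.Sum using (_⊎_; inj₁; inj₂)
open import Data.Unit using (⊤; tt)
open import Data.Vec using (Vec; []; _∷_)
import Data.Vec.Properties as Vec
open import Function using (_∘_; case_of_)
open import Relation.Binary using (DecidableEquality)
open import Relation.Binary.PropositionalEquality
open import Relation.Nullary using (¬_; Dec; yes; no; contradiction; ¬?; does)
open import Relation.Nullary.Decidable using (_×-dec_; decidable-stable)


-- Laurent polynomials acting on power series in z and q

-- Trailing zeros break the ring laws for coefficient lists, so a Laurent polynomial is studied
-- through the operator it induces on power series: products become composites, and reordering
-- factors becomes commutation of operators. With the powers of z^(-1) cleared, the factors are q^i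
-- + z for 0 ≤ i < n and 1 + z q^j for 1 ≤ j ≤ m. So b - a takes each value from -(n - 1) to m once,
-- and these factors form one chain. For a bond with p sites of the chain before its first site and
-- r sites after that site, a forward and then a backward move has the scalar (p + 1) r, as in the
-- irreducible sl₂-module. Its successive differences r - p drop by 2 per site, just as -2 (b - a)
-- does; hence the commutator depends only on size and weight. No exterior signs appear, because a
-- one moves to an adjacent site and never passes another one. Complete reducibility and division
-- are both avoided: injectivity comes from a descent on eigenvalues, and dimensions are compared by
-- elimination over ℤ.

Series : Set
Series = ℕ → ℕ → ℤ

infix 4 _≐_
infixl 6 _⊞_
infixr 7 _⊡_

_≐_ : Series → Series → Set
F ≐ G = ∀ r w → F r w ≡ G r w

𝟘 δ₀ : Series
𝟘 r w = + 0
δ₀ zero    zero    = + 1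
δ₀ zero    (suc w) = + 0
δ₀ (suc r) w       = + 0

_⊞_ : Series → Series → Series
(F ⊞ G) r w = F r w + G r w

_⊡_ : ℤ → Series → Series
(c ⊡ F) r w = c * F r w

z· q· : Series → Series
z· F zero    w = + 0
z· F (suc r) w = F r w
q· F r zero    = + 0
q· F r (suc w) = F r w

actP : Poly → Series → Series
actP []      F = 𝟘
actP (a ∷ p) F = a ⊡ F ⊞ q· (actP p F)

act : List Poly → Series → Series
act []       F = 𝟘
act (c ∷ cs) F = actP c F ⊞ z· (act cs F)

z·-cong : ∀ {F G} → F ≐ G → z· F ≐ z· G
z·-cong e zero    w = refl
z·-cong e (suc r) w = e r w

q·-cong : ∀ {F G} → F ≐ G → q· F ≐ q· G
q·-cong e r zero    = refl
q·-cong e r (suc w) = e r w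

z·-⊞ : ∀ F G → z· (F ⊞ G) ≐ z· F ⊞ z· G
z·-⊞ F G zero    w = refl
z·-⊞ F G (suc r) w = refl

q·-⊞ : ∀ F G → q· (F ⊞ G) ≐ q· F ⊞ q· G
q·-⊞ F G r zero    = refl
q·-⊞ F G r (suc w) = refl

z·-⊡ : ∀ c F → z· (c ⊡ F) ≐ c ⊡ z· F
z·-⊡ c F zero    w = sym (*-zeroʳ c)
z·-⊡ c F (suc r) w = refl

q·-⊡ : ∀ c F → q· (c ⊡ F) ≐ c ⊡ q· F
q·-⊡ c F r zero    = sym (*-zeroʳ c)
q·-⊡ c F r (suc w) = refl

z·-q· : ∀ F → z· (q· F) ≐ q· (z· F)
z·-q· F zero    zero    = refl
z·-q· F zero    (suc w) = refl
z·-q· F (suc r) zero    = refl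
z·-q· F (suc r) (suc w) = refl

z·-𝟘 : z· 𝟘 ≐ 𝟘
z·-𝟘 zero    w = refl
z·-𝟘 (suc r) w = refl

q·-𝟘 : q· 𝟘 ≐ 𝟘
q·-𝟘 r zero    = refl
q·-𝟘 r (suc w) = refl

⊞-interchange : ∀ a b c d → (a + b) + (c + d) ≡ (a + c) + (b + d)
⊞-interchange = solve-∀

-- These are the maps linear over ℤ[z, q]. They commute with every `act p`, and `act p` is itself
-- one of them, which yields `act-comm` with no ring laws for lists.
record Equivariant (T : Series → Series) : Set where
  field
    cong-T : ∀ {F G} → F ≐ G → T F ≐ T G
    T-⊞    : ∀ F G → T (F ⊞ G) ≐ T F ⊞ T G
    T-⊡    : ∀ c F → T (c ⊡ F) ≐ c ⊡ T F
    T-z    : ∀ F → T (z· F) ≐ z· (T F)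
    T-q    : ∀ F → T (q· F) ≐ q· (T F)

  T-𝟘 : T 𝟘 ≐ 𝟘
  T-𝟘 r w = trans (T-⊡ (+ 0) 𝟘 r w) (*-zeroˡ (T 𝟘 r w))

  T-actP : ∀ p F → T (actP p F) ≐ actP p (T F)
  T-actP []      F r w = T-𝟘 r w
  T-actP (a ∷ p) F r w = trans (T-⊞ (a ⊡ F) (q· (actP p F)) r w)
    (cong₂ _+_ (T-⊡ a F r w) (trans (T-q (actP p F) r w) (q·-cong (T-actP p F) r w)))

  T-act : ∀ p F → T (act p F) ≐ act p (T F)
  T-act []      F r w = T-𝟘 r w
  T-act (c ∷ p) F r w = trans (T-⊞ (actP c F) (z· (act p F)) r w)
    (cong₂ _+_ (T-actP c F r w) (trans (T-z (act p F) r w) (z·-cong (T-act p F) r w)))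

open Equivariant

actP-equivariant : ∀ p → Equivariant (actP p)
actP-equivariant [] = record
  { cong-T = λ _ _ _ → refl
  ; T-⊞ = λ _ _ _ _ → refl
  ; T-⊡ = λ c _ _ _ → sym (*-zeroʳ c)
  ; T-z = λ _ r w → sym (z·-𝟘 r w)
  ; T-q = λ _ r w → sym (q·-𝟘 r w) }
actP-equivariant (a ∷ p) = record
  { cong-T = λ e r w → cong₂ _+_ (cong (a *_) (e r w)) (q·-cong (cong-T ih e) r w)
  ; T-⊞ = λ F G r w → trans
      (cong (_+_ (a * (F r w + G r w))) (trans (q·-cong (T-⊞ ih F G) r w) (q·-⊞ (actP p F) (actP p G) r w)))
      (distrib a (F r w) (G r w) (q· (actP p F) r w) (q· (actP p G) r w))
  ; T-⊡ = λ c F r w → trans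
      (cong (_+_ (a * (c * F r w))) (trans (q·-cong (T-⊡ ih c F) r w) (q·-⊡ c (actP p F) r w)))
      (scale a c (F r w) (q· (actP p F) r w))
  ; T-z = λ F r w → trans
      (cong₂ _+_ (sym (z·-⊡ a F r w))
        (trans (q·-cong (T-z ih F) r w) (sym (z·-q· (actP p F) r w))))
      (sym (z·-⊞ (a ⊡ F) (q· (actP p F)) r w))
  ; T-q = λ F r w → trans
      (cong₂ _+_ (sym (q·-⊡ a F r w)) (q·-cong (T-q ih F) r w))
      (sym (q·-⊞ (a ⊡ F) (q· (actP p F)) r w)) }
  where
  ih = actP-equivariant p
  distrib : ∀ a x y u v → a * (x + y) + (u + v) ≡ (a * x + u) + (a * y + v)
  distrib = solve-∀
  scale : ∀ a c x u → a * (c * x) + c * u ≡ c * (a * x + u)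
  scale = solve-∀

act-equivariant : ∀ p → Equivariant (act p)
act-equivariant [] = actP-equivariant []
act-equivariant (c ∷ p) = record
  { cong-T = λ e r w → cong₂ _+_ (cong-T hc e r w) (z·-cong (cong-T ih e) r w)
  ; T-⊞ = λ F G r w → trans
      (cong₂ _+_ (T-⊞ hc F G r w) (trans (z·-cong (T-⊞ ih F G) r w) (z·-⊞ (act p F) (act p G) r w)))
      (⊞-interchange (actP c F r w) (actP c G r w) (z· (act p F) r w) (z· (act p G) r w))
  ; T-⊡ = λ a F r w → trans
      (cong₂ _+_ (T-⊡ hc a F r w) (trans (z·-cong (T-⊡ ih a F) r w) (z·-⊡ a (act p F) r w)))
      (factor a (actP c F r w) (z· (act p F) r w))
  ; T-z = λ F r w → trans
      (cong₂ _+_ (T-z hc F r w) (z·-cong (T-z ih F) r w))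
      (sym (z·-⊞ (actP c F) (z· (act p F)) r w))
  ; T-q = λ F r w → trans
      (cong₂ _+_ (T-q hc F r w) (trans (z·-cong (T-q ih F) r w) (z·-q· (act p F) r w)))
      (sym (q·-⊞ (actP c F) (z· (act p F)) r w)) }
  where
  hc = actP-equivariant c
  ih = act-equivariant p
  factor : ∀ a x u → a * x + a * u ≡ a * (x + u)
  factor = solve-∀

act-cong : ∀ p {F G} → F ≐ G → act p F ≐ act p G
act-cong p = cong-T (act-equivariant p)

act-comm : ∀ p q F → act p (act q F) ≐ act q (act p F)
act-comm p = T-act (act-equivariant p)

actP-addP : ∀ p q F → actP (addP p q) F ≐ actP p F ⊞ actP q F
actP-addP []      q       F r w = sym (+-identityˡ (actP q F r w))
actP-addP (a ∷ p) []      F r w = sym (+-identityʳ (actP (a ∷ p) F r w))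
actP-addP (a ∷ p) (b ∷ q) F r w = trans
  (cong (_+_ ((a + b) * F r w)) (trans (q·-cong (actP-addP p q F) r w) (q·-⊞ (actP p F) (actP q F) r w)))
  (distrib a b (F r w) (q· (actP p F) r w) (q· (actP q F) r w))
  where
  distrib : ∀ a b x u v → (a + b) * x + (u + v) ≡ (a * x + u) + (b * x + v)
  distrib = solve-∀

actP-scaleP : ∀ c p F → actP (scaleP c p) F ≐ c ⊡ actP p F
actP-scaleP c []      F r w = sym (*-zeroʳ c)
actP-scaleP c (a ∷ p) F r w = trans
  (cong (_+_ (c * a * F r w)) (trans (q·-cong (actP-scaleP c p F) r w) (q·-⊡ c (actP p F) r w)))
  (factor c a (F r w) (q· (actP p F) r w))
  where
  factor : ∀ c a x u → c * a * x + c * u ≡ c * (a * x + u)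
  factor = solve-∀

actP-mulP : ∀ p q F → actP (mulP p q) F ≐ actP p (actP q F)
actP-mulP []      q F r w = refl
actP-mulP (a ∷ p) q F r w = trans
  (actP-addP (scaleP a q) (+ 0 ∷ mulP p q) F r w)
  (cong₂ _+_ (actP-scaleP a q F r w)
    (trans (cong (_+ q· (actP (mulP p q) F) r w) (*-zeroˡ (F r w)))
      (trans (+-identityˡ _) (q·-cong (actP-mulP p q F) r w))))

act-addL' : ∀ p q F → act (addL' p q) F ≐ act p F ⊞ act q F
act-addL' []      q       F r w = sym (+-identityˡ (act q F r w))
act-addL' (a ∷ p) []      F r w = sym (+-identityʳ (act (a ∷ p) F r w))
act-addL' (a ∷ p) (b ∷ q) F r w = trans
  (cong₂ _+_ (actP-addP a b F r w)
    (trans (z·-cong (act-addL' p q F) r w) (z·-⊞ (act p F) (act q F) r w)))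
  (⊞-interchange (actP a F r w) (actP b F r w) (z· (act p F) r w) (z· (act q F) r w))

act-map-scaleP : ∀ c p F → act (map (scaleP c) p) F ≐ c ⊡ act p F
act-map-scaleP c []      F r w = sym (*-zeroʳ c)
act-map-scaleP c (a ∷ p) F r w = trans
  (cong₂ _+_ (actP-scaleP c a F r w)
    (trans (z·-cong (act-map-scaleP c p F) r w) (z·-⊡ c (act p F) r w)))
  (factor c (actP a F r w) (z· (act p F) r w))
  where
  factor : ∀ a x u → a * x + a * u ≡ a * (x + u)
  factor = solve-∀

act-map-mulP : ∀ c p F → act (map (mulP c) p) F ≐ actP c (act p F)
act-map-mulP c []      F r w = sym (T-𝟘 (actP-equivariant c) r w)
act-map-mulP c (a ∷ p) F r w = trans
  (cong₂ _+_ (actP-mulP c a F r w)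
    (trans (z·-cong (act-map-mulP c p F) r w) (sym (T-z (actP-equivariant c) (act p F) r w))))
  (sym (T-⊞ (actP-equivariant c) (actP a F) (z· (act p F)) r w))

act-mulL' : ∀ p q F → act (mulL' p q) F ≐ act p (act q F)
act-mulL' []      q F r w = refl
act-mulL' (a ∷ p) q F r w = trans
  (act-addL' (map (mulP a) q) ([] ∷ mulL' p q) F r w)
  (cong₂ _+_ (act-map-mulP a q F r w)
    (trans (+-identityˡ _) (z·-cong (act-mulL' p q F) r w)))

actP-δ₀-zero : ∀ p w → actP p δ₀ zero w ≡ coeff p w
actP-δ₀-zero []      w       = refl
actP-δ₀-zero (a ∷ p) zero    = unit a
  where
  unit : ∀ a → a * + 1 + + 0 ≡ a
  unit = solve-∀
actP-δ₀-zero (a ∷ p) (suc w) = trans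
  (cong (_+ actP p δ₀ zero w) (*-zeroʳ a)) (trans (+-identityˡ _) (actP-δ₀-zero p w))

actP-δ₀-suc : ∀ p r w → actP p δ₀ (suc r) w ≡ + 0
actP-δ₀-suc []      r w       = refl
actP-δ₀-suc (a ∷ p) r zero    = cong (_+ + 0) (*-zeroʳ a)
actP-δ₀-suc (a ∷ p) r (suc w) = cong₂ _+_ (*-zeroʳ a) (actP-δ₀-suc p r w)

-- `δ₀` is the series 1, so an identity between operators becomes one between coefficients,
-- insensitive to trailing zeros.
act-δ₀ : ∀ p r w → act p δ₀ r w ≡ coeff (nth p r) w
act-δ₀ []      r       w = refl
act-δ₀ (c ∷ p) zero    w = trans (+-identityʳ _) (actP-δ₀-zero c w)
act-δ₀ (c ∷ p) (suc r) w = trans (cong (_+ act p δ₀ r w) (actP-δ₀-suc c r w))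
  (trans (+-identityˡ _) (act-δ₀ p r w))

-- The factors of the product as binomials

binomial : ℕ → ℕ → List Poly
binomial a b = qPow a ∷ qPow b ∷ []

right-factor left-factor : ℕ → Laurent
right-factor j = oneL ⊕ negL (-qz ⊗ constL (qPow j))
left-factor  j = oneL ⊕ negL (-z⁻¹ ⊗ constL (qPow j))

-- The signs cancel: 1 - (-qz) q^j = 1 + z q^(j+1).
act-right-factor : ∀ j F → act (Laurent.cs (right-factor j)) F ≐ act (binomial 0 (suc j)) F
act-right-factor j F r w = trans
  (trans (act-addL' (((+ 1) ∷ []) ∷ []) (map (scaleP (- (+ 1))) (Laurent.cs (-qz ⊗ constL (qPow j)))) F r w)
    (cong (_+_ (act (((+ 1) ∷ []) ∷ []) F r w))
      (trans (act-map-scaleP (- (+ 1)) (Laurent.cs (-qz ⊗ constL (qPow j))) F r w)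
        (cong (- (+ 1) *_) (act-mulL' (Laurent.cs -qz) (qPow j ∷ []) F r w)))))
  (expand r w)
  where
  degree0 : ∀ x → (x + + 0) + - + 1 * (+ 0 + + 0) ≡ x + + 0
  degree0 = solve-∀
  zeros : ∀ x g f → (x + + 0) + - + 1 * (+ 0 + (+ 0 * g + + 0 + + 0)) ≡ x + (+ 0 * f + + 0 + + 0)
  zeros = solve-∀
  degree1 : ∀ x g f y → (x + + 0) + - + 1 * (+ 0 + (+ 0 * g + (- + 1 * (y + + 0) + + 0) + + 0))
                      ≡ x + (+ 0 * f + y + + 0)
  degree1 = solve-∀
  expand : ∀ r w → act (((+ 1) ∷ []) ∷ []) F r w + - (+ 1) * act (Laurent.cs -qz) (act (qPow j ∷ []) F) r w
         ≡ act (binomial 0 (suc j)) F r w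
  expand zero    w       = degree0 (+ 1 * F zero w + q· 𝟘 zero w)
  expand (suc r) zero    rewrite z·-𝟘 r zero = 
    zeros (+ 1 * F (suc r) zero + + 0) (actP (qPow j) F r zero + + 0) (F r zero)
  expand (suc r) (suc w) rewrite z·-𝟘 r w | z·-𝟘 r (suc w) | q·-𝟘 r w =
    degree1 (+ 1 * F (suc r) (suc w) + + 0) (actP (qPow j) F r (suc w) + + 0) (F r (suc w)) (actP (qPow j) F r w)

-- Here 1 + z^(-1) q^j = z^(-1) (q^j + z), and the factor z^(-1) is held by the offset `low`, which
-- the operator does not see.
act-left-factor : ∀ j F → act (Laurent.cs (left-factor j)) F ≐ act (binomial j 0) F
act-left-factor j F r w = trans
  (trans (act-addL' ([] ∷ ((+ 1) ∷ []) ∷ []) (map (scaleP (- (+ 1))) (Laurent.cs (-z⁻¹ ⊗ constL (qPow j)))) F r w)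
    (cong (_+_ (act ([] ∷ ((+ 1) ∷ []) ∷ []) F r w))
      (trans (act-map-scaleP (- (+ 1)) (Laurent.cs (-z⁻¹ ⊗ constL (qPow j))) F r w)
        (cong (- (+ 1) *_) (act-mulL' (Laurent.cs -z⁻¹) (qPow j ∷ []) F r w)))))
  (expand r w)
  where
  degree0 : ∀ x → (+ 0 + + 0) + - + 1 * (- + 1 * (x + + 0) + + 0 + + 0) ≡ x + + 0
  degree0 = solve-∀
  degree1 : ∀ y x → (+ 0 + (y + + 0)) + - + 1 * (- + 1 * (x + + 0) + + 0 + + 0) ≡ x + (y + + 0)
  degree1 = solve-∀
  expand : ∀ r w → act ([] ∷ ((+ 1) ∷ []) ∷ []) F r w + - (+ 1) * act (Laurent.cs -z⁻¹) (act (qPow j ∷ []) F) r w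
         ≡ act (binomial j 0) F r w
  expand zero    w rewrite q·-𝟘 zero w = degree0 (actP (qPow j) F zero w)
  expand (suc r) w rewrite q·-𝟘 (suc r) w | z·-𝟘 r w =
    degree1 (+ 1 * F r w + q· 𝟘 r w) (actP (qPow j) F (suc r) w)

actᵏ : ℕ → List Poly → Series → Series
actᵏ zero    p F = F
actᵏ (suc k) p F = act p (actᵏ k p F)

act-oneL : ∀ F → act (Laurent.cs oneL) F ≐ F
act-oneL F r w rewrite q·-𝟘 r w | z·-𝟘 r w = unit (F r w)
  where
  unit : ∀ x → + 1 * x + + 0 + + 0 ≡ x
  unit = solve-∀

act-^L : ∀ k x F → act (Laurent.cs (x ^L k)) F ≐ actᵏ k (Laurent.cs x) F
act-^L zero    x F     = act-oneL F
act-^L (suc k) x F r w = trans (act-mulL' (Laurent.cs x) (Laurent.cs (x ^L k)) F r w)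
                               (act-cong (Laurent.cs x) (act-^L k x F) r w)

-- Linear algebra over ℤ

i*j≡0⇒j≡0 : ∀ i {j} → i ≢ + 0 → i * j ≡ + 0 → j ≡ + 0
i*j≡0⇒j≡0 i i≢0 e with i*j≡0⇒i≡0∨j≡0 i e
... | inj₁ i≡0 = contradiction i≡0 i≢0
... | inj₂ j≡0 = j≡0

a*0+b*0≡0 : ∀ a b {x y} → x ≡ + 0 → y ≡ + 0 → a * x + b * y ≡ + 0
a*0+b*0≡0 a b refl refl = zeros a b
  where
  zeros : ∀ a b → a * + 0 + b * + 0 ≡ + 0
  zeros = solve-∀

module _ {X : Set} where

  Linear : ((X → ℤ) → ℤ) → Set
  Linear φ = ∀ a b f g → φ (λ x → a * f x + b * g x) ≡ a * φ f + b * φ g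

  Subspace : ((X → ℤ) → Set) → Set
  Subspace P = ∀ a b f g → P f → P g → P (λ x → a * f x + b * g x)

  kernel-subspace : ∀ φ → Linear φ → Subspace (λ f → φ f ≡ + 0)
  kernel-subspace φ lin a b f g φf φg = trans (lin a b f g) (a*0+b*0≡0 a b φf φg)

  -- Gaussian elimination: the points x i detect the vectors g i, and
  -- subtracting multiples of a pivot preserves this for the other points.
  common-zero : ∀ {m n} → m ℕ.< n →
    (φ : Fin m → (X → ℤ) → ℤ) → (∀ i → Linear (φ i)) →
    (g : Fin n → X → ℤ) (x : Fin n → X) →
    (∀ i → g i (x i) ≢ + 0) → (∀ i j → i ≢ j → g i (x j) ≡ + 0) →
    ∃ λ f → (∃ λ y → f y ≢ + 0) × (∀ i → φ i f ≡ + 0)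
          × (∀ P → Subspace P → (∀ i → P (g i)) → P f)
  common-zero {zero} {suc n} _ φ lin g x diag off =
    g zero , (x zero , diag zero) , (λ ()) , (λ P _ Pg → Pg zero)
  common-zero {suc m} {suc n} m<n φ lin g x diag off
    with any? (λ i → ¬? (φ zero (g i) ≟ + 0))
  ... | no none =
    let f , nz , φf , P∋f = common-zero (ℕ.<-trans (ℕ.n<1+n m) m<n)
                              (φ ∘ suc) (lin ∘ suc) g x diag off
        φ₀f = P∋f (λ f → φ zero f ≡ + 0) (kernel-subspace (φ zero) (lin zero))
                (λ i → decidable-stable (φ zero (g i) ≟ + 0) (λ ne → none (i , ne)))
    in f , nz , (λ { zero → φ₀f ; (suc i) → φf i }) , P∋f
  ... | yes (p , pivot≢0) =
    let f , nz , φf , P∋f = common-zero (ℕ.s<s⁻¹ m<n) (φ ∘ suc) (lin ∘ suc) g′ x′ diag′ off′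
        φ₀f = P∋f (λ f → φ zero f ≡ + 0) (kernel-subspace (φ zero) (lin zero)) φ₀g′
    in f , nz , (λ { zero → φ₀f ; (suc i) → φf i })
       , (λ P sub Pg → P∋f P sub (λ i → sub a (b i) _ _ (Pg (punchIn p i)) (Pg p)))
    where
    -- Fraction-free elimination: `g′ i` is the combination of `g (punchIn p i)` and the pivot `g p`
    -- that `φ zero` kills, scaled by `a` in place of a division.
    a = φ zero (g p)
    x′ = x ∘ punchIn p
    b : Fin n → ℤ
    b i = - φ zero (g (punchIn p i))
    g′ : Fin n → X → ℤ
    g′ i y = a * g (punchIn p i) y + b i * g p y
    g-pivot : ∀ j → g p (x′ j) ≡ + 0
    g-pivot j = off p (punchIn p j) (punchInᵢ≢i p j ∘ sym)
    off′ : ∀ i j → i ≢ j → g′ i (x′ j) ≡ + 0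
    off′ i j i≢j = a*0+b*0≡0 a (b i) (off _ _ (i≢j ∘ punchIn-injective p i j)) (g-pivot j)
    drop-zero : ∀ u v → u + v * + 0 ≡ u
    drop-zero = solve-∀
    diag′ : ∀ i → g′ i (x′ i) ≢ + 0
    diag′ i e = diag (punchIn p i) (i*j≡0⇒j≡0 a pivot≢0
      (trans (sym (trans (cong (λ t → a * g (punchIn p i) (x′ i) + b i * t) (g-pivot i))
                         (drop-zero _ (b i)))) e))
    cancel : ∀ u v → u * v + - v * u ≡ + 0
    cancel = solve-∀
    φ₀g′ : ∀ i → φ zero (g′ i) ≡ + 0
    φ₀g′ i = trans (lin zero a (b i) _ _) (cancel a (φ zero (g (punchIn p i))))

  lookup-injective : ∀ {xs : List X} → Unique xs → ∀ i j → lookup xs i ≡ lookup xs j → i ≡ j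
  lookup-injective (x∉ ∷ u) zero    zero    e = refl
  lookup-injective (x∉ ∷ u) zero    (suc j) e = contradiction e (All.lookup x∉ (∈-lookup j))
  lookup-injective (x∉ ∷ u) (suc i) zero    e = contradiction (sym e) (All.lookup x∉ (∈-lookup i))
  lookup-injective (x∉ ∷ u) (suc i) (suc j) e = cong suc (lookup-injective u i j e)

  module _ (_≟X_ : DecidableEquality X) where

    indicator : X → X → ℤ
    indicator x y = if does (x ≟X y) then + 1 else + 0

    indicator-≡ : ∀ x → indicator x x ≢ + 0
    indicator-≡ x with x ≟X x
    ... | yes _ = λ ()
    ... | no ne = contradiction refl ne

    indicator-≢ : ∀ {x y} → x ≢ y → indicator x y ≡ + 0
    indicator-≢ {x} {y} x≢y with x ≟X y
    ... | yes e = contradiction e x≢y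
    ... | no _  = refl

    -- If `xs` were longer, its indicators would outnumber the conditions at the points of `ys`, and
    -- some nonzero combination would satisfy them all.
    injective⇒length≤ : (Q : (X → ℤ) → X → ℤ) → (∀ y → Linear (λ f → Q f y)) →
      (xs ys : List X) → Unique xs →
      (∀ f → (∀ x → x ∉ xs → f x ≡ + 0) → (∀ y → y ∈ ys → Q f y ≡ + 0) → ∀ x → f x ≡ + 0) →
      length xs ℕ.≤ length ys
    injective⇒length≤ Q lin xs ys uniq inj = ℕ.≮⇒≥ λ ys<xs →
      let f , (x , fx≢0) , Qf , P∋f = common-zero ys<xs
            (λ i f → Q f (lookup ys i)) (λ i → lin (lookup ys i))
            (λ i → indicator (lookup xs i)) (lookup xs)
            (λ i → indicator-≡ _) (λ i j i≢j → indicator-≢ (i≢j ∘ lookup-injective uniq i j))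
          -- Lying in every subspace that contains the generators stands for lying in their span;
          -- here the subspace is that of functions supported on `xs`.
          vanish = P∋f (λ f → ∀ x → x ∉ xs → f x ≡ + 0)
            (λ a b f g f₀ g₀ x x∉ → a*0+b*0≡0 a b (f₀ x x∉) (g₀ x x∉))
            (λ i x x∉ → indicator-≢ (λ e → x∉ (subst (_∈ xs) e (∈-lookup i))))
      in fx≢0 (inj f vanish
           (λ y y∈ → subst (λ y → Q f y ≡ + 0) (sym (lookup-index y∈)) (Qf (index y∈))) x)

  maps-zero : (P : (X → ℤ) → X → ℤ) → (∀ {f g} → f ≗ g → P f ≗ P g) → (∀ x → Linear (λ f → P f x)) →
              ∀ {f} → (∀ x → f x ≡ + 0) → ∀ x → P f x ≡ + 0
  maps-zero P P-cong P-linear {f} f₀ x = trans (P-cong (λ y → trans (f₀ y) (sym (zeros (f y)))) x)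
    (trans (P-linear x (+ 0) (+ 0) f f) (zeros (P f x)))
    where
    zeros : ∀ u → + 0 * u + + 0 * u ≡ + 0
    zeros = solve-∀

  -- The weight argument for sl₂: a vector of level ℓ killed by Q generates
  -- under P a chain on which Q P acts by the negative scalars - κ, but
  -- the chain dies at level 0.
  module Descent
    (P Q : (X → ℤ) → X → ℤ)
    (P-cong : ∀ {f g} → f ≗ g → P f ≗ P g) (P-linear : ∀ x → Linear (λ f → P f x))
    (Q-cong : ∀ {f g} → f ≗ g → Q f ≗ Q g) (Q-linear : ∀ x → Linear (λ f → Q f x))
    (V : ℕ → (X → ℤ) → Set)
    (P-lowers : ∀ {ℓ f} → V (suc ℓ) f → V ℓ (P f))
    (P-bottom : ∀ {f} → V 0 f → ∀ x → P f x ≡ + 0)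
    (h : ℕ → ℤ) (h-positive : ∀ ℓ → 0ℤ < h (suc ℓ) → 0ℤ < h ℓ)
    (commutator : ∀ {ℓ f} → V ℓ f → ∀ x → P (Q f) x ≡ Q (P f) x + h ℓ * f x)
    where

    P-scale : ∀ c f x → P (λ y → c * f y) x ≡ c * P f x
    P-scale c f x = trans (P-cong (λ y → sym (drop (c * f y) (f y))) x)
      (trans (P-linear x c (+ 0) f f) (drop (c * P f x) (P f x)))
      where
      drop : ∀ u v → u + + 0 * v ≡ u
      drop = solve-∀

    P-zero : ∀ {f} → (∀ x → f x ≡ + 0) → ∀ x → P f x ≡ + 0
    P-zero = maps-zero P P-cong P-linear

    Q-zero : ∀ {f} → (∀ x → f x ≡ + 0) → ∀ x → Q f x ≡ + 0
    Q-zero = maps-zero Q Q-cong Q-linear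

    chain : ∀ ℓ f κ → V ℓ f → 0ℤ < h ℓ → 0ℤ < κ →
            (∀ x → Q (P f) x ≡ - κ * f x) → ∀ x → P f x ≡ + 0
    eigenvector-zero : ∀ ℓ f κ → V ℓ f → 0ℤ < h ℓ → 0ℤ < κ →
                       (∀ x → Q (P f) x ≡ - κ * f x) → ∀ x → f x ≡ + 0

    chain zero    f κ Vf _   _   _   x = P-bottom Vf x
    chain (suc ℓ) f κ Vf 0<h 0<κ QPf =
      -- Applying `P` to Q P f = - κ f and commuting gives Q P (P f) = - (κ + h ℓ) P f. The scalar
      -- moves further from 0, so it never vanishes.
      eigenvector-zero ℓ (P f) (κ + h ℓ) (P-lowers Vf) 0<h′ (+-mono-< 0<κ 0<h′) λ x →
        move (Q (P (P f)) x) κ (h ℓ) (P f x)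
          (trans (sym (commutator (P-lowers Vf) x)) (trans (P-cong QPf x) (P-scale (- κ) f x)))
      where
      0<h′ = h-positive ℓ 0<h
      isolate : ∀ u k h v → u ≡ (u + h * v) - h * v
      isolate = solve-∀
      collect : ∀ k h v → - k * v - h * v ≡ - (k + h) * v
      collect = solve-∀
      move : ∀ u k h v → u + h * v ≡ - k * v → u ≡ - (k + h) * v
      move u k h v e = trans (isolate u k h v) (trans (cong (_- h * v) e) (collect k h v))

    eigenvector-zero ℓ f κ Vf 0<h 0<κ QPf x = i*j≡0⇒j≡0 (- κ)
      (λ e → <-irrefl (sym (trans (sym (neg-involutive κ)) (cong -_ e))) 0<κ)
      (trans (sym (QPf x)) (Q-zero (chain ℓ f κ Vf 0<h 0<κ QPf) x))

    Q-injective : ∀ ℓ f → V ℓ f → 0ℤ < h ℓ → (∀ x → Q f x ≡ + 0) → ∀ x → f x ≡ + 0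
    -- From Q f = 0 the commutator leaves Q P f = - h ℓ f, which fixes the initial κ.
    Q-injective ℓ f Vf 0<h Qf = eigenvector-zero ℓ f (h ℓ) Vf 0<h 0<h λ x →
      move (Q (P f) x) (h ℓ) (f x) (trans (sym (commutator Vf x)) (P-zero Qf x))
      where
      isolate : ∀ u h v → u ≡ (u + h * v) + - h * v
      isolate = solve-∀
      move : ∀ u h v → u + h * v ≡ + 0 → u ≡ - h * v
      move u h v e = trans (isolate u h v) (trans (cong (_+ - h * v) e) (+-identityˡ _))

-- Bit strings and the action of sl₂

-- A site contributes the factor q^a + z q^b; u and d are the coefficients of
-- the forward and backward moves across the bond to the next site.
record Site : Set where
  constructor site
  field
    a b : ℕ
    u d : ℤ

open Site

State : List Site → Set
State ss = Vec Bool (length ss)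

bond : Bool → Site → ℤ
bond true  = u
bond false = d

bit : Bool → ℕ
bit true  = 1
bit false = 0

wt : Site → Bool → ℕ
wt s true  = b s
wt s false = a s

size : ∀ {n} → Vec Bool n → ℕ
size []       = 0
size (x ∷ xs) = bit x ℕ.+ size xs

weight : ∀ ss → State ss → ℕ
weight []       []       = 0
weight (s ∷ ss) (x ∷ xs) = wt s x ℕ.+ weight ss xs

-- The value at x of a vector moved forward (true) or backward (false) across
-- the first bond, so the argument is evaluated at the predecessor of x.
hop : Bool → ∀ {n} → (Vec Bool (suc (suc n)) → ℤ) → Vec Bool (suc (suc n)) → ℤ
hop true  f (false ∷ true  ∷ xs) = f (true ∷ false ∷ xs)
hop true  f (false ∷ false ∷ xs) = + 0
hop true  f (true  ∷ y     ∷ xs) = + 0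
hop false f (true  ∷ false ∷ xs) = f (false ∷ true ∷ xs)
hop false f (true  ∷ true  ∷ xs) = + 0
hop false f (false ∷ y     ∷ xs) = + 0

op : Bool → ∀ ss → (State ss → ℤ) → State ss → ℤ
op c []           f x        = + 0
op c (s ∷ [])     f x        = + 0
op c (s ∷ t ∷ ss) f (x ∷ xs) = bond c s * hop c f (x ∷ xs) + op c (t ∷ ss) (f ∘ (x ∷_)) xs

lift : ∀ {n} → ((Vec Bool n → ℤ) → Vec Bool n → ℤ) → (Vec Bool (suc n) → ℤ) → Vec Bool (suc n) → ℤ
lift T f (x ∷ xs) = T (f ∘ (x ∷_)) xs

hop-cong : ∀ c {n} {f g : Vec Bool (suc (suc n)) → ℤ} → f ≗ g → hop c f ≗ hop c g
hop-cong true  e (false ∷ true  ∷ xs) = e _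
hop-cong true  e (false ∷ false ∷ xs) = refl
hop-cong true  e (true  ∷ y     ∷ xs) = refl
hop-cong false e (true  ∷ false ∷ xs) = e _
hop-cong false e (true  ∷ true  ∷ xs) = refl
hop-cong false e (false ∷ y     ∷ xs) = refl

hop-linear : ∀ c {n} (x : Vec Bool (suc (suc n))) → Linear (λ f → hop c f x)
hop-linear true  (false ∷ true  ∷ xs) p q f g = refl
hop-linear true  (false ∷ false ∷ xs) p q f g = sym (a*0+b*0≡0 p q refl refl)
hop-linear true  (true  ∷ y     ∷ xs) p q f g = sym (a*0+b*0≡0 p q refl refl)
hop-linear false (true  ∷ false ∷ xs) p q f g = refl
hop-linear false (true  ∷ true  ∷ xs) p q f g = sym (a*0+b*0≡0 p q refl refl)
hop-linear false (false ∷ y     ∷ xs) p q f g = sym (a*0+b*0≡0 p q refl refl)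

op-cong : ∀ c ss {f g : State ss → ℤ} → f ≗ g → op c ss f ≗ op c ss g
op-cong c []           e x        = refl
op-cong c (s ∷ [])     e x        = refl
op-cong c (s ∷ t ∷ ss) e (x ∷ xs) =
  cong₂ _+_ (cong (bond c s *_) (hop-cong c e (x ∷ xs))) (op-cong c (t ∷ ss) (e ∘ (x ∷_)) xs)

op-linear : ∀ c ss (x : State ss) → Linear (λ f → op c ss f x)
op-linear c []           x        p q f g = sym (a*0+b*0≡0 p q refl refl)
op-linear c (s ∷ [])     x        p q f g = sym (a*0+b*0≡0 p q refl refl)
op-linear c (s ∷ t ∷ ss) (x ∷ xs) p q f g = trans
  (cong₂ _+_ (cong (bond c s *_) (hop-linear c (x ∷ xs) p q f g))
             (op-linear c (t ∷ ss) xs p q (f ∘ (x ∷_)) (g ∘ (x ∷_))))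
  (regroup (bond c s) p q (hop c f (x ∷ xs)) (hop c g (x ∷ xs)) _ _)
  where
  regroup : ∀ k p q m n i j → k * (p * m + q * n) + (p * i + q * j) ≡ p * (k * m + i) + q * (k * n + j)
  regroup = solve-∀

op-zero : ∀ c ss {f : State ss → ℤ} → (∀ x → f x ≡ + 0) → ∀ x → op c ss f x ≡ + 0
op-zero c ss = maps-zero (op c ss) (op-cong c ss) (op-linear c ss)


bond-zero : ∀ k {i} → k * + 0 + i ≡ i
bond-zero k {i} = trans (cong (_+ i) (*-zeroʳ k)) (+-identityˡ i)

-- Hops in opposite directions on different bonds commute: if the bonds share
-- a site, both composites vanish.
hop-op-comm : ∀ c t ss (f : Vec Bool (suc (length (t ∷ ss))) → ℤ) x y xs →
  op (not c) (t ∷ ss) (λ z → hop c f (x ∷ z)) (y ∷ xs) ≡ hop c (lift (op (not c) (t ∷ ss)) f) (x ∷ y ∷ xs)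
hop-op-comm true  t []       f false true  xs = refl
hop-op-comm true  t []       f false false xs = refl
hop-op-comm true  t []       f true  y     xs = refl
hop-op-comm false t []       f true  false xs = refl
hop-op-comm false t []       f true  true  xs = refl
hop-op-comm false t []       f false y     xs = refl
hop-op-comm true  t (s ∷ ss) f true  y     xs = op-zero false (t ∷ s ∷ ss) (λ { (_ ∷ _) → refl }) (y ∷ xs)
hop-op-comm true  t (s ∷ ss) f false false (z ∷ xs) =
  trans (bond-zero (d t)) (op-zero false (s ∷ ss) (λ _ → refl) (z ∷ xs))
hop-op-comm true  t (s ∷ ss) f false true  (true ∷ xs) = refl
hop-op-comm true  t (s ∷ ss) f false true  (false ∷ xs) = refl
hop-op-comm false t (s ∷ ss) f false y     xs = op-zero true (t ∷ s ∷ ss) (λ { (_ ∷ _) → refl }) (y ∷ xs)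
hop-op-comm false t (s ∷ ss) f true  true  (z ∷ xs) =
  trans (bond-zero (u t)) (op-zero true (s ∷ ss) (λ _ → refl) (z ∷ xs))
hop-op-comm false t (s ∷ ss) f true  false (true ∷ xs) = refl
hop-op-comm false t (s ∷ ss) f true  false (false ∷ xs) = refl

-- On one bond the strings 10 and 01 span the two-dimensional sl₂-module, while 00 and 11 are
-- trivial.
hop-comm : ∀ {n} (f : Vec Bool (suc (suc n)) → ℤ) x y xs →
  hop false (hop true f) (x ∷ y ∷ xs) ≡ hop true (hop false f) (x ∷ y ∷ xs) + (+ bit x - + bit y) * f (x ∷ y ∷ xs)
hop-comm f true  true  xs = sym (trans (+-identityˡ _) (*-zeroˡ (f (true ∷ true ∷ xs))))
hop-comm f true  false xs = sym (trans (+-identityˡ _) (*-identityˡ _))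
hop-comm f false true  xs = cancel (f (false ∷ true ∷ xs))
  where
  cancel : ∀ v → + 0 ≡ v + - + 1 * v
  cancel = solve-∀
hop-comm f false false xs = sym (trans (+-identityˡ _) (*-zeroˡ (f (false ∷ false ∷ xs))))

energy : ∀ ss → State ss → ℤ
energy []           x            = + 0
energy (s ∷ [])     x            = + 0
energy (s ∷ t ∷ ss) (x ∷ y ∷ xs) = u s * d s * (+ bit x - + bit y) + energy (t ∷ ss) (y ∷ xs)

-- Only a bond paired with itself contributes. The mixed terms between the first bond and the rest,
-- `lU` and `lD`, occur equally in both orders by `hop-op-comm`.
op-comm : ∀ ss (f : State ss → ℤ) x →
  op false ss (op true ss f) x ≡ op true ss (op false ss f) x + energy ss x * f x
op-comm []           f x = refl
op-comm (s ∷ [])     f x = refl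
op-comm (s ∷ t ∷ ss) f (x ∷ y ∷ xs) = trans
  (cong₂ _+_ (cong (d s *_) hop-op) (op-op (op-comm (t ∷ ss) (f ∘ (x ∷_)) (y ∷ xs))))
  (trans (regroup (u s) (d s) (hop true (hop false f) X) (+ bit x - + bit y) (f X) lU lD
                  (op true (t ∷ ss) (op false (t ∷ ss) (f ∘ (x ∷_))) (y ∷ xs)) (energy (t ∷ ss) (y ∷ xs)))
    (cong (_+ (energy (s ∷ t ∷ ss) X * f X))
      (sym (cong₂ _+_ (cong (u s *_) hop-op′) op-op′))))
  where
  X = x ∷ y ∷ xs
  U = op true (t ∷ ss)
  D = op false (t ∷ ss)
  lU = U (λ z → hop false f (x ∷ z)) (y ∷ xs)
  lD = hop true (lift D f) X
  split : ∀ c (L : (State (s ∷ t ∷ ss) → ℤ) → ℤ) → (∀ {f g} → f ≗ g → L f ≡ L g) → Linear L →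
          L (op c (s ∷ t ∷ ss) f) ≡ bond c s * L (hop c f) + L (lift (op c (t ∷ ss)) f)
  split c L L-cong L-lin = trans
    (L-cong λ { (x ∷ xs) → cong (_+_ (bond c s * hop c f (x ∷ xs))) (sym (*-identityˡ _)) })
    (trans (L-lin (bond c s) (+ 1) (hop c f) (lift (op c (t ∷ ss)) f))
           (cong (_+_ (bond c s * L (hop c f))) (*-identityˡ _)))
  hop-op : hop false (op true (s ∷ t ∷ ss) f) X
         ≡ u s * (hop true (hop false f) X + (+ bit x - + bit y) * f X) + lU
  hop-op = trans (split true (λ g → hop false g X) (λ e → hop-cong false e X) (hop-linear false X))
    (cong₂ _+_ (cong (u s *_) (hop-comm f x y xs)) (sym (hop-op-comm false t ss f x y xs)))
  op-op : D (U (f ∘ (x ∷_))) (y ∷ xs)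
            ≡ U (D (f ∘ (x ∷_))) (y ∷ xs) + energy (t ∷ ss) (y ∷ xs) * f X →
          D (λ z → op true (s ∷ t ∷ ss) f (x ∷ z)) (y ∷ xs)
        ≡ u s * lD + (U (D (f ∘ (x ∷_))) (y ∷ xs) + energy (t ∷ ss) (y ∷ xs) * f X)
  op-op ih = trans (split true (λ g → D (g ∘ (x ∷_)) (y ∷ xs)) (λ e → op-cong false (t ∷ ss) (e ∘ (x ∷_)) (y ∷ xs))
                  (λ p q g h → op-linear false (t ∷ ss) (y ∷ xs) p q (g ∘ (x ∷_)) (h ∘ (x ∷_))))
    (cong₂ _+_ (cong (u s *_) (hop-op-comm true t ss f x y xs)) ih)
  hop-op′ : hop true (op false (s ∷ t ∷ ss) f) X ≡ d s * hop true (hop false f) X + lD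
  hop-op′ = split false (λ g → hop true g X) (λ e → hop-cong true e X) (hop-linear true X)
  op-op′ : U (λ z → op false (s ∷ t ∷ ss) f (x ∷ z)) (y ∷ xs) ≡ d s * lU + U (D (f ∘ (x ∷_))) (y ∷ xs)
  op-op′ = split false (λ g → U (g ∘ (x ∷_)) (y ∷ xs)) (λ e → op-cong true (t ∷ ss) (e ∘ (x ∷_)) (y ∷ xs))
                  (λ p q g h → op-linear true (t ∷ ss) (y ∷ xs) p q (g ∘ (x ∷_)) (h ∘ (x ∷_)))
  regroup : ∀ u d AB n v lU lD UD e →
    d * (u * (AB + n * v) + lU) + (u * lD + (UD + e * v)) ≡ u * (d * AB + lD) + (d * lU + UD) + (u * d * n + e) * v
  regroup = solve-∀

-- A bond with nonzero coefficients must raise the weight by 1 on a forward move.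
Linked : Site → Site → Set
Linked s t = (u s ≡ + 0 × d s ≡ + 0) ⊎ (suc (b s ℕ.+ a t) ≡ a s ℕ.+ b t)

Graded : List Site → Set
Graded []           = ⊤
Graded (s ∷ [])     = ⊤
Graded (s ∷ t ∷ ss) = Linked s t × Graded (t ∷ ss)

Step : Bool → ℕ → ℕ → Set
Step true  v w = suc v ≡ w
Step false v w = v ≡ suc w

Step-+ : ∀ c k {v w} → Step c v w → Step c (k ℕ.+ v) (k ℕ.+ w)
Step-+ true  k {v} refl = sym (ℕ.+-suc k v)
Step-+ false k {w = w} refl = ℕ.+-suc k w

hop-vanishes : ∀ c s t ss (f : State (s ∷ t ∷ ss) → ℤ) x → Linked s t →
  (∀ y → size y ≡ size x → Step c (weight (s ∷ t ∷ ss) y) (weight (s ∷ t ∷ ss) x) → f y ≡ + 0) →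
  bond c s * hop c f x ≡ + 0
hop-vanishes true  s t ss f (false ∷ false ∷ xs) _ _ = *-zeroʳ (u s)
hop-vanishes true  s t ss f (true  ∷ y     ∷ xs) _ _ = *-zeroʳ (u s)
hop-vanishes false s t ss f (false ∷ y     ∷ xs) _ _ = *-zeroʳ (d s)
hop-vanishes false s t ss f (true  ∷ true  ∷ xs) _ _ = *-zeroʳ (d s)
hop-vanishes true  s t ss f (false ∷ true  ∷ xs) (inj₁ (e , _)) _ = trans (cong (_* f (true ∷ false ∷ xs)) e)
  (*-zeroˡ (f (true ∷ false ∷ xs)))
hop-vanishes false s t ss f (true  ∷ false ∷ xs) (inj₁ (_ , e)) _ = trans (cong (_* f (false ∷ true ∷ xs)) e)
  (*-zeroˡ (f (false ∷ true ∷ xs)))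
hop-vanishes true  s t ss f (false ∷ true  ∷ xs) (inj₂ e) f₀ = trans
  (cong (u s *_) (f₀ (true ∷ false ∷ xs) refl
    (trans (cong suc (sym (ℕ.+-assoc (b s) (a t) _)))
      (trans (cong (ℕ._+ weight ss xs) e) (ℕ.+-assoc (a s) (b t) _))))) (*-zeroʳ (u s))
hop-vanishes false s t ss f (true  ∷ false ∷ xs) (inj₂ e) f₀ = trans
  (cong (d s *_) (f₀ (false ∷ true ∷ xs) refl
    (trans (sym (ℕ.+-assoc (a s) (b t) _))
      (trans (cong (ℕ._+ weight ss xs) (sym e)) (cong suc (ℕ.+-assoc (b s) (a t) _)))))) (*-zeroʳ (d s))

-- This is the grading in pointwise form: every predecessor of `x` reached with a nonzero
-- coefficient has the same size and a weight one step away.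
op-vanishes : ∀ c ss → Graded ss → (f : State ss → ℤ) → ∀ x →
  (∀ y → size y ≡ size x → Step c (weight ss y) (weight ss x) → f y ≡ + 0) → op c ss f x ≡ + 0
op-vanishes c []           gr f x        f₀ = refl
op-vanishes c (s ∷ [])     gr f x        f₀ = refl
op-vanishes c (s ∷ t ∷ ss) (l , gr) f (x ∷ xs) f₀ = cong₂ _+_
  (hop-vanishes c s t ss f (x ∷ xs) l f₀)
  (op-vanishes c (t ∷ ss) gr (f ∘ (x ∷_)) xs
    (λ y e st → f₀ (x ∷ y) (cong (bit x ℕ.+_) e) (Step-+ c (wt s x) st)))

-- Given the bond products before and after a site, its share of the energy is
-- α - 2 (b - a) when occupied; p is the product before the first site.
Balanced : ℤ → ℤ → List Site → Set
Balanced α p []       = p ≡ + 0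
Balanced α p (s ∷ ss) = u s * d s - p ≡ α - + 2 * (+ b s - + a s) × Balanced α (u s * d s) ss

weight₀ : List Site → ℕ
weight₀ []       = 0
weight₀ (s ∷ ss) = a s ℕ.+ weight₀ ss

site-energy : ∀ α e s x → e ≡ α - + 2 * (+ b s - + a s) →
  e * + bit x ≡ α * + bit x + + 2 * + a s - + 2 * + wt s x
site-energy α e s true  eq = trans (cong (_* + 1) eq) (occupied α (+ a s) (+ b s))
  where
  occupied : ∀ α a b → (α - + 2 * (b - a)) * + 1 ≡ α * + 1 + + 2 * a - + 2 * b
  occupied = solve-∀
site-energy α e s false eq = empty e α (+ a s)
  where
  empty : ∀ e α a → e * + 0 ≡ α * + 0 + + 2 * a - + 2 * a
  empty = solve-∀

-- Summation by parts.
energy-by-parts : ∀ α p s ss → Balanced α p (s ∷ ss) → ∀ x xs →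
  energy (s ∷ ss) (x ∷ xs) - p * + bit x
    ≡ α * + size (x ∷ xs) + + 2 * + weight₀ (s ∷ ss) - + 2 * + weight (s ∷ ss) (x ∷ xs)
energy-by-parts α p s [] (eq , e≡0) x []
  rewrite ℕ.+-identityʳ (bit x) | ℕ.+-identityʳ (a s) | ℕ.+-identityʳ (wt s x) =
  trans (start p (+ bit x)) (site-energy α (+ 0 - p) s x (trans (cong (_- p) (sym e≡0)) eq))
  where
  start : ∀ p n → + 0 - p * n ≡ (+ 0 - p) * n
  start = solve-∀
energy-by-parts α p s (t ∷ ss) (eq , bal) x (y ∷ xs) = trans
  (split (u s * d s) p (+ bit x) (+ bit y) (energy (t ∷ ss) (y ∷ xs)))
  (trans (cong₂ _+_ (site-energy α (u s * d s - p) s x eq) (energy-by-parts α (u s * d s) t ss bal y xs))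
    (merge α (+ bit x) (+ a s) (+ wt s x) _ _ _))
  where
  split : ∀ e p m n E → e * (m - n) + E - p * m ≡ (e - p) * m + (E - e * n)
  split = solve-∀
  merge : ∀ α m a w M A W → (α * m + + 2 * a - + 2 * w) + (α * M + + 2 * A - + 2 * W)
                          ≡ α * (m + M) + + 2 * (a + A) - + 2 * (w + W)
  merge = solve-∀

-- Each occupied site contributes α - 2 (b - a), and the sum of b - a over occupied sites is the
-- weight less `weight₀`, the weight of the string without ones.
energy-weight : ∀ α ss → Balanced α (+ 0) ss → ∀ x →
  energy ss x ≡ α * + size x + + 2 * + weight₀ ss - + 2 * + weight ss x
energy-weight α []       bal []       = zeros α
  where
  zeros : ∀ α → + 0 ≡ α * + 0 + + 2 * + 0 - + 2 * + 0
  zeros = solve-∀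
energy-weight α (s ∷ ss) bal (x ∷ xs) =
  trans (pad (energy (s ∷ ss) (x ∷ xs)) (+ bit x)) (energy-by-parts α (+ 0) s ss bal x xs)
  where
  pad : ∀ e n → e ≡ e - + 0 * n
  pad = solve-∀

-- A crude bound is enough: it serves only to make chains of forward moves end.
max-weight : List Site → ℕ
max-weight []       = 0
max-weight (s ∷ ss) = a s ℕ.+ b s ℕ.+ max-weight ss

weight≤max-weight : ∀ ss x → weight ss x ℕ.≤ max-weight ss
weight≤max-weight []       []           = ℕ.z≤n
weight≤max-weight (s ∷ ss) (true  ∷ xs) = ℕ.+-mono-≤ (ℕ.m≤n+m (b s) (a s)) (weight≤max-weight ss xs)
weight≤max-weight (s ∷ ss) (false ∷ xs) = ℕ.+-mono-≤ (ℕ.m≤m+n (a s) (b s)) (weight≤max-weight ss xs)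

-- Enumeration of strings by size and weight

module _ {A : Set} where

  shift : ℕ → (ℕ → List A) → ℕ → List A
  shift zero    g w       = g w
  shift (suc k) g zero    = []
  shift (suc k) g (suc w) = shift k g w

  shift-∈⁻ : ∀ k g w {x} → x ∈ shift k g w → ∃ λ v → w ≡ k ℕ.+ v × x ∈ g v
  shift-∈⁻ zero    g w       x∈ = w , refl , x∈
  shift-∈⁻ (suc k) g (suc w) x∈ =
    let v , e , x∈g = shift-∈⁻ k g w x∈ in v , cong suc e , x∈g

  shift-∈⁺ : ∀ k g w {x} → x ∈ g w → x ∈ shift k g (k ℕ.+ w)
  shift-∈⁺ zero    g w x∈ = x∈
  shift-∈⁺ (suc k) g w x∈ = shift-∈⁺ k g w x∈

  shift-unique : ∀ k g → (∀ w → Unique (g w)) → ∀ w → Unique (shift k g w)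
  shift-unique zero    g u w       = u w
  shift-unique (suc k) g u zero    = []
  shift-unique (suc k) g u (suc w) = shift-unique k g u w

-- The recursion copies multiplication by q^a + z q^b, with `shift` in the role of a power of q, so
-- the lengths are the coefficients of the product. The `++ []` is the absent z-term at size 0.
states : ∀ ss → ℕ → ℕ → List (State ss)
states []       zero    zero    = [] ∷ []
states []       zero    (suc w) = []
states []       (suc r) w       = []
states (s ∷ ss) zero    w = map (false ∷_) (shift (a s) (states ss zero) w) ++ []
states (s ∷ ss) (suc r) w = map (false ∷_) (shift (a s) (states ss (suc r)) w)
                         ++ map (true ∷_) (shift (b s) (states ss r) w)

states-sound : ∀ ss r w {x} → x ∈ states ss r w → size x ≡ r × weight ss x ≡ w
states-sound []       zero    zero    (here refl) = refl , refl
states-sound (s ∷ ss) zero    w x∈ with ∈-++⁻ (map (false ∷_) (shift (a s) (states ss zero) w)) x∈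
... | inj₁ x∈₀ with ∈-map⁻ (false ∷_) x∈₀
... | xs , xs∈ , refl with shift-∈⁻ (a s) (states ss zero) w xs∈
... | v , refl , xs∈′ = let e , e′ = states-sound ss zero v xs∈′ in e , cong (a s ℕ.+_) e′
states-sound (s ∷ ss) (suc r) w x∈ with ∈-++⁻ (map (false ∷_) (shift (a s) (states ss (suc r)) w)) x∈
states-sound (s ∷ ss) (suc r) w x∈ | inj₁ x∈₀ with ∈-map⁻ (false ∷_) x∈₀
... | xs , xs∈ , refl with shift-∈⁻ (a s) (states ss (suc r)) w xs∈
... | v , refl , xs∈′ = let e , e′ = states-sound ss (suc r) v xs∈′ in e , cong (a s ℕ.+_) e′
states-sound (s ∷ ss) (suc r) w x∈ | inj₂ x∈₁ with ∈-map⁻ (true ∷_) x∈₁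
... | xs , xs∈ , refl with shift-∈⁻ (b s) (states ss r) w xs∈
... | v , refl , xs∈′ = let e , e′ = states-sound ss r v xs∈′ in cong suc e , cong (b s ℕ.+_) e′

states-complete : ∀ ss x → x ∈ states ss (size x) (weight ss x)
states-complete []       []           = here refl
states-complete (s ∷ ss) (true  ∷ xs) = ∈-++⁺ʳ (map (false ∷_) (shift (a s) (states ss (suc (size xs))) _))
  (∈-map⁺ (true ∷_) (shift-∈⁺ (b s) (states ss (size xs)) (weight ss xs) (states-complete ss xs)))
states-complete (s ∷ ss) (false ∷ xs) with size xs in eq
... | zero  = ∈-++⁺ˡ (∈-map⁺ (false ∷_) (shift-∈⁺ (a s) (states ss zero) (weight ss xs)
                (subst (λ r → xs ∈ states ss r (weight ss xs)) eq (states-complete ss xs))))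
... | suc r = ∈-++⁺ˡ (∈-map⁺ (false ∷_) (shift-∈⁺ (a s) (states ss (suc r)) (weight ss xs)
                (subst (λ r → xs ∈ states ss r (weight ss xs)) eq (states-complete ss xs))))

states-unique : ∀ ss r w → Unique (states ss r w)
states-unique []       zero    zero    = All.[] ∷ []
states-unique []       zero    (suc w) = []
states-unique []       (suc r) w       = []
states-unique (s ∷ ss) zero    w = Unique.++⁺
  (Unique.map⁺ (proj₂ ∘ Vec.∷-injective) (shift-unique (a s) (states ss zero) (states-unique ss zero) w))
  [] (λ { (_ , ()) })
states-unique (s ∷ ss) (suc r) w = Unique.++⁺
  (Unique.map⁺ (proj₂ ∘ Vec.∷-injective) (shift-unique (a s) (states ss (suc r)) (states-unique ss (suc r)) w))
  (Unique.map⁺ (proj₂ ∘ Vec.∷-injective) (shift-unique (b s) (states ss r) (states-unique ss r) w))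
  (λ (x∈₀ , x∈₁) → case (∈-map⁻ (false ∷_) x∈₀ , ∈-map⁻ (true ∷_) x∈₁) of
    λ { ((_ , _ , refl) , (_ , _ , ())) })

0<k-2*-pred : ∀ k ℓ → 0ℤ < k - + 2 * + suc ℓ → 0ℤ < k - + 2 * + ℓ
0<k-2*-pred k ℓ 0<h = <-≤-trans 0<h (+-monoʳ-≤ k (neg-mono-≤ (*-monoˡ-≤-nonNeg (+ 2) (+≤+ (ℕ.n≤1+n ℓ)))))

-- Comparison of adjacent weights

module Strings (ss : List Site) (graded : Graded ss) (α : ℤ) (balanced : Balanced α (+ 0) ss) (r : ℕ) where

  U D : (State ss → ℤ) → State ss → ℤ
  U = op true ss
  D = op false ss

  center : ℤ
  center = α * + r + + 2 * + weight₀ ss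

  Supp : (ℕ → Set) → (State ss → ℤ) → Set
  Supp W f = ∀ x → ¬ (size x ≡ r × W (weight ss x)) → f x ≡ + 0

  _≟S_ : (x y : State ss) → Dec (x ≡ y)
  _≟S_ = Vec.≡-dec Bool._≟_

  -- Off the support both sides vanish, so the energy may be replaced by its constant value there.
  -- `W` is left general to serve the gradings by weight and by distance from a top weight.
  energy-Supp : ∀ W → (∀ w → Dec (W w)) → ∀ c → (∀ w → W w → center - + 2 * + w ≡ c) →
    ∀ {f} → Supp W f → ∀ x → energy ss x * f x ≡ c * f x
  energy-Supp W W? c c-eq {f} Vf x with (size x ℕ.≟ r) ×-dec W? (weight ss x)
  ... | yes (refl , Ww) = cong (_* f x) (trans (energy-weight α ss balanced x) (c-eq _ Ww))
  ... | no ¬g = trans (cong (energy ss x *_) (Vf x ¬g)) (trans (*-zeroʳ (energy ss x))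
                  (sym (trans (cong (c *_) (Vf x ¬g)) (*-zeroʳ c))))

  -- The image of a vector of weight `v` lives on weight `w`, so vanishing on the finitely many
  -- listed strings is vanishing everywhere, and injectivity becomes an inequality of lengths.
  states-≤ : ∀ c v w → (∀ {i} → Step c v i → i ≡ w) →
    (∀ f → Supp (_≡ v) f → (∀ x → op c ss f x ≡ + 0) → ∀ x → f x ≡ + 0) →
    length (states ss r v) ℕ.≤ length (states ss r w)
  states-≤ c v w st inj = injective⇒length≤ _≟S_ (op c ss) (op-linear c ss)
    (states ss r v) (states ss r w) (states-unique ss r v)
    λ f f₀ opf → let Vf = λ x ¬g → f₀ x (¬g ∘ states-sound ss r v) in
      inj f Vf λ x → case (size x ℕ.≟ r) ×-dec (weight ss x ℕ.≟ w) of λ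
        { (yes (refl , refl)) → opf x (states-complete ss x)
        ; (no ¬g) → op-vanishes c ss graded f x λ y e s → Vf y
            λ (e₁ , e₂) → ¬g (trans (sym e) e₁ , st (subst (λ i → Step c i (weight ss x)) e₂ s)) }

  states-increasing : ∀ w → 0ℤ < center - + 2 * + w →
    length (states ss r w) ℕ.≤ length (states ss r (suc w))
  states-increasing w 0<h = states-≤ true w (suc w) sym
    (λ f Vf → Q-injective w f Vf 0<h)
    where
    V : ℕ → (State ss → ℤ) → Set
    V ℓ = Supp (_≡ ℓ)
    lowers : ∀ {ℓ f} → V (suc ℓ) f → V ℓ (D f)
    lowers {ℓ} {f} Vf x ¬g = op-vanishes false ss graded f x λ y e st → Vf y
      λ (e₁ , e₂) → ¬g (trans (sym e) e₁ , ℕ.suc-injective (trans (sym st) e₂))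
    bottom : ∀ {f} → V 0 f → ∀ x → D f x ≡ + 0
    bottom {f} Vf x = op-vanishes false ss graded f x λ y e st → Vf y
      λ (_ , e₂) → case trans (sym st) e₂ of λ ()
    eigen : ∀ ℓ w → w ≡ ℓ → center - + 2 * + w ≡ center - + 2 * + ℓ
    eigen ℓ w e = cong (λ w → center - + 2 * + w) e
    commutator : ∀ {ℓ f} → V ℓ f → ∀ x → D (U f) x ≡ U (D f) x + (center - + 2 * + ℓ) * f x
    commutator {ℓ} {f} Vf x = trans (op-comm ss f x)
      (cong (_+_ (U (D f) x)) (energy-Supp (_≡ ℓ) (ℕ._≟ ℓ) (center - + 2 * + ℓ) (eigen ℓ) Vf x))
    open Descent D U (op-cong false ss) (op-linear false ss) (op-cong true ss) (op-linear true ss)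
      V lowers bottom (λ ℓ → center - + 2 * + ℓ) (0<k-2*-pred center) commutator

  states-decreasing : ∀ w → center - + 2 * + suc w < 0ℤ →
    length (states ss r (suc w)) ℕ.≤ length (states ss r w)
  states-decreasing w h<0 = states-≤ false (suc w) w (sym ∘ ℕ.suc-injective)
    (λ f Vf → Q-injective top f
      (λ x ¬g → Vf x (λ (e , e′) → ¬g (e , trans (cong (ℕ._+ top) e′) (ℕ.+-comm (suc w) top))))
      (subst (0ℤ <_) (start (+ top) (+ suc w) center) (neg-mono-< h<0)))
    where
    top = max-weight ss
    -- The level of weight v is M - v, written additively to avoid truncated subtraction. With this
    -- `M`, weight `suc w` has level `top`, and level 0 would need a weight above `top`.
    M = top ℕ.+ suc w
    start : ∀ t w c → - (c - + 2 * w) ≡ (+ 2 * (t + w) - c) - + 2 * t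
    start = solve-∀
    rearrange : ∀ DU UD e v h → UD ≡ DU + e → e ≡ - h * v → DU ≡ UD + h * v
    rearrange DU UD e v h refl refl = cancel DU h v
      where
      cancel : ∀ DU h v → DU ≡ DU + - h * v + h * v
      cancel = solve-∀
    eigen : ∀ ℓ w → w ℕ.+ ℓ ≡ M → center - + 2 * + w ≡ - ((+ 2 * + M - center) - + 2 * + ℓ)
    eigen ℓ w e = trans (rearranged (+ w) (+ ℓ) center)
      (cong (λ m → - ((+ 2 * + m - center) - + 2 * + ℓ)) e)
      where
      rearranged : ∀ w ℓ c → c - + 2 * w ≡ - ((+ 2 * (w + ℓ) - c) - + 2 * ℓ)
      rearranged = solve-∀
    V : ℕ → (State ss → ℤ) → Set
    V ℓ = Supp (λ w → w ℕ.+ ℓ ≡ M)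
    lowers : ∀ {ℓ f} → V (suc ℓ) f → V ℓ (U f)
    lowers {ℓ} {f} Vf x ¬g = op-vanishes true ss graded f x λ y e st → Vf y
      λ (e₁ , e₂) → ¬g (trans (sym e) e₁ , trans (cong (ℕ._+ ℓ) (sym st)) (trans (sym (ℕ.+-suc _ ℓ)) e₂))
    bottom : ∀ {f} → V 0 f → ∀ x → U f x ≡ + 0
    bottom {f} Vf x = op-vanishes true ss graded f x λ y e st → Vf y
      λ (_ , e₂) → ℕ.<-irrefl (trans (sym (ℕ.+-identityʳ _)) e₂)
        (ℕ.≤-<-trans (weight≤max-weight ss y) (ℕ.m<m+n top ℕ.z<s))
    h : ℕ → ℤ
    h ℓ = (+ 2 * + M - center) - + 2 * + ℓ
    commutator : ∀ {ℓ f} → V ℓ f → ∀ x → U (D f) x ≡ D (U f) x + h ℓ * f x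
    commutator {ℓ} {f} Vf x = rearrange (U (D f) x) (D (U f) x) (energy ss x * f x) (f x) (h ℓ) (op-comm ss f x)
      (energy-Supp (λ w → w ℕ.+ ℓ ≡ M) (λ w → w ℕ.+ ℓ ℕ.≟ M) (- h ℓ) (eigen ℓ) Vf x)
    open Descent U D (op-cong true ss) (op-linear true ss) (op-cong false ss) (op-linear false ss)
      V lowers bottom h (0<k-2*-pred (+ 2 * + M - center)) commutator

-- The sites of the generalized Gauss polynomial

apply : List Site → Series → Series
apply []       F = F
apply (s ∷ ss) F = act (binomial (a s) (b s)) (apply ss F)

module _ {A : Set} where

  actP-qPow : ∀ k F (g : ℕ → List A) r → (∀ w → F r w ≡ + length (g w)) →
    ∀ w → actP (qPow k) F r w ≡ + length (shift k g w)
  actP-qPow zero    F g r e w rewrite q·-𝟘 r w =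
    trans (+-identityʳ _) (trans (*-identityˡ (F r w)) (e w))
  actP-qPow (suc k) F g r e zero    = trans (+-identityʳ _) (*-zeroˡ (F r zero))
  actP-qPow (suc k) F g r e (suc w) = trans
    (cong (_+ actP (qPow k) F r w) (*-zeroˡ (F r (suc w))))
    (trans (+-identityˡ _) (actP-qPow k F g r e w))

length-map-++ : ∀ {A B : Set} (f g : A → B) xs ys → length (map f xs ++ map g ys) ≡ length xs ℕ.+ length ys
length-map-++ f g xs ys = trans (length-++ (map f xs)) (cong₂ ℕ._+_ (length-map f xs) (length-map g ys))

apply-δ₀ : ∀ ss r w → apply ss δ₀ r w ≡ + length (states ss r w)
apply-δ₀ []       zero    zero    = refl
apply-δ₀ []       zero    (suc w) = refl
apply-δ₀ []       (suc r) w       = refl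
apply-δ₀ (s ∷ ss) zero    w = trans
  (cong (_+ + 0) (actP-qPow (a s) (apply ss δ₀) (states ss zero) zero (apply-δ₀ ss zero) w))
  (cong +_ (sym (length-map-++ (false ∷_) (true ∷_) (shift (a s) (states ss zero) w) [])))
apply-δ₀ (s ∷ ss) (suc r) w rewrite z·-𝟘 r w = trans
  (cong₂ _+_ (actP-qPow (a s) (apply ss δ₀) (states ss (suc r)) (suc r) (apply-δ₀ ss (suc r)) w)
    (trans (+-identityʳ _) (actP-qPow (b s) (apply ss δ₀) (states ss r) r (apply-δ₀ ss r) w)))
  (cong +_ (sym (length-map-++ (false ∷_) (true ∷_)
    (shift (a s) (states ss (suc r)) w) (shift (b s) (states ss r) w))))

-- The raising coefficient across a bond with r sites of the chain after it;
-- the lowering one is (p + 1) r, with p sites before the bond's first site.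
step : ℕ → ℤ
step zero    = + 0
step (suc _) = + 1

step-* : ∀ c r → step r * (c * + r) ≡ c * + r
step-* c zero    = sym (*-zeroʳ c)
step-* c (suc r) = *-identityˡ _

-- The exponent i descends here, while that of `right-sites` ascends, so that b - a increases by 1
-- throughout, including at the junction. Here `p` counts the sites already placed in the chain.
left-sites : ℕ → ℕ → ℕ → List Site → List Site
left-sites m p zero    tl = tl
left-sites m p (suc i) tl = site i 0 (step (i ℕ.+ m)) (+ suc p * + (i ℕ.+ m)) ∷ left-sites m (suc p) i tl

right-sites : ℕ → ℕ → ℕ → List Site → List Site
right-sites p j zero    tl = tl
right-sites p j (suc r) tl = site 0 (suc j) (step r) (+ suc p * + r) ∷ right-sites (suc p) (suc j) r tl

blocks : ℕ → ℕ → ℕ → List Site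
blocks m n zero    = []
blocks m n (suc k) = left-sites m 0 n (right-sites n 0 m (blocks m n k))

-- The difference (p + 1) r - p (r + 1) = r - p is affine in the position. The expression for `α` is
-- invariant under passing to the next site, and the product p r reaches 0 at the end of the chain,
-- where the next one starts afresh.
right-balanced : ∀ α p j r tl → α ≡ + r - + p + + 2 * + j + + 1 → Balanced α (+ 0) tl →
  Balanced α (+ p * + r) (right-sites p j r tl)
right-balanced α p j zero    tl eq bal = subst (λ c → Balanced α c tl) (sym (*-zeroʳ (+ p))) bal
right-balanced α p j (suc r) tl eq bal =
  trans (cong (_- + p * + suc r) (step-* (+ suc p) r))
    (trans (local (+ p) (+ j) (+ r)) (cong (_- + 2 * (+ suc j - + 0)) (sym eq)))
  , subst (λ c → Balanced α c (right-sites (suc p) (suc j) r tl)) (sym (step-* (+ suc p) r))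
      (right-balanced α (suc p) (suc j) r tl (trans eq (next (+ p) (+ j) (+ r))) bal)
  where
  local : ∀ p j r → (+ 1 + p) * r - p * (+ 1 + r) ≡ ((+ 1 + r) - p + + 2 * j + + 1) - + 2 * ((+ 1 + j) - + 0)
  local = solve-∀
  next : ∀ p j r → (+ 1 + r) - p + + 2 * j + + 1 ≡ r - (+ 1 + p) + + 2 * (+ 1 + j) + + 1
  next = solve-∀

left-balanced : ∀ α m p i tl → α ≡ + m - + p - + i + + 1 → Balanced α (+ 0) tl →
  Balanced α (+ p * + (i ℕ.+ m)) (left-sites m p i (right-sites (p ℕ.+ i) 0 m tl))
left-balanced α m p zero    tl eq bal rewrite ℕ.+-identityʳ p =
  right-balanced α p 0 m tl (trans eq (simp (+ m) (+ p))) bal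
  where
  simp : ∀ m p → m - p - + 0 + + 1 ≡ m - p + + 2 * + 0 + + 1
  simp = solve-∀
left-balanced α m p (suc i) tl eq bal =
  trans (cong (_- + p * + (suc i ℕ.+ m)) (step-* (+ suc p) (i ℕ.+ m)))
    (trans (local (+ m) (+ p) (+ i)) (cong (_- + 2 * (+ 0 - + i)) (sym eq)))
  , subst (λ q → Balanced α (step (i ℕ.+ m) * (+ suc p * + (i ℕ.+ m)))
                   (left-sites m (suc p) i (right-sites q 0 m tl))) (sym (ℕ.+-suc p i))
      (subst (λ c → Balanced α c (left-sites m (suc p) i (right-sites (suc p ℕ.+ i) 0 m tl)))
        (sym (step-* (+ suc p) (i ℕ.+ m)))
        (left-balanced α m (suc p) i tl (trans eq (next (+ m) (+ p) (+ i))) bal))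
  where
  local : ∀ m p i → (+ 1 + p) * (i + m) - p * (+ 1 + (i + m)) ≡ (m - p - (+ 1 + i) + + 1) - + 2 * (+ 0 - i)
  local = solve-∀
  next : ∀ m p i → m - p - (+ 1 + i) + + 1 ≡ m - (+ 1 + p) - i + + 1
  next = solve-∀

blocks-balanced : ∀ m n k → Balanced (+ m - + n + + 1) (+ 0) (blocks m n k)
blocks-balanced m n zero    = refl
blocks-balanced m n (suc k) = left-balanced (+ m - + n + + 1) m 0 n (blocks m n k)
  (simp (+ m) (+ n)) (blocks-balanced m n k)
  where
  simp : ∀ m n → m - n + + 1 ≡ m - + 0 - n + + 1
  simp = solve-∀

right-graded : ∀ p j r tl → Graded tl → Graded (right-sites p j r tl)
right-graded p j zero          tl       gr = gr
right-graded p j (suc zero)    []       gr = tt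
-- At the end of a chain r = 0 makes both coefficients vanish, so nothing moves into the next chain.
right-graded p j (suc zero)    (t ∷ tl) gr = inj₁ (refl , *-zeroʳ (+ suc p)) , gr
right-graded p j (suc (suc r)) tl       gr =
  inj₂ (cong (λ i → suc (suc i)) (ℕ.+-identityʳ j)) , right-graded (suc p) (suc j) (suc r) tl gr

left-graded : ∀ m p i q tl → Graded tl → Graded (left-sites m p i (right-sites q 0 m tl))
left-graded m       p zero          q tl       gr = right-graded q 0 m tl gr
left-graded zero    p (suc zero)    q []       gr = tt
left-graded zero    p (suc zero)    q (t ∷ tl) gr = inj₁ (refl , *-zeroʳ (+ suc p)) , gr
-- The junction inside a chain: b - a passes from 0 to 1.
left-graded (suc m) p (suc zero)    q tl       gr = inj₂ refl , right-graded q 0 (suc m) tl gr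
left-graded m       p (suc (suc i)) q tl       gr =
  inj₂ (cong suc (sym (ℕ.+-identityʳ i))) , left-graded m (suc p) (suc i) q tl gr

blocks-graded : ∀ m n k → Graded (blocks m n k)
blocks-graded m n zero    = tt
blocks-graded m n (suc k) = left-graded m 0 n n (blocks m n k) (blocks-graded m n k)

-- Identification of the chains with the product

apply-left-sites : ∀ m p i tl F →
  apply (left-sites m p i tl) F ≐ act (Laurent.cs (poch -z⁻¹ i)) (apply tl F)
apply-left-sites m p zero    tl F r w = sym (act-oneL (apply tl F) r w)
apply-left-sites m p (suc i) tl F r w = trans
  (act-cong (binomial i 0) (apply-left-sites m (suc p) i tl F) r w)
  (trans (act-comm (binomial i 0) P G r w)
    (sym (trans (act-mulL' P (Laurent.cs (left-factor i)) G r w)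
                (act-cong P (act-left-factor i G) r w))))
  where
  G = apply tl F
  P = Laurent.cs (poch -z⁻¹ i)

-- `poch` grows by its last factor, whereas `right-sites` is built from its first; commutation
-- brings the last factor to the front.
right-sites-last : ∀ p j r tl F →
  apply (right-sites p j (suc r) tl) F ≐ act (binomial 0 (suc (j ℕ.+ r))) (apply (right-sites p j r tl) F)
right-sites-last p j zero    tl F rewrite ℕ.+-identityʳ j = λ _ _ → refl
right-sites-last p j (suc r) tl F x w rewrite ℕ.+-suc j r = trans
  (act-cong (binomial 0 (suc j)) (right-sites-last (suc p) (suc j) r tl F) x w)
  (act-comm (binomial 0 (suc j)) (binomial 0 (suc (suc j ℕ.+ r))) (apply (right-sites (suc p) (suc j) r tl) F) x w)

apply-right-sites : ∀ p r tl F →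
  apply (right-sites p 0 r tl) F ≐ act (Laurent.cs (poch -qz r)) (apply tl F)
apply-right-sites p zero    tl F x w = sym (act-oneL (apply tl F) x w)
apply-right-sites p (suc r) tl F x w = trans (right-sites-last p 0 r tl F x w)
  (trans (act-cong (binomial 0 (suc r)) (apply-right-sites p r tl F) x w)
    (trans (act-comm (binomial 0 (suc r)) P G x w)
      (sym (trans (act-mulL' P (Laurent.cs (right-factor r)) G x w)
                  (act-cong P (act-right-factor r G) x w)))))
  where
  G = apply tl F
  P = Laurent.cs (poch -qz r)

-- The chains alternate the two kinds of factors, while the Gauss polynomial groups each kind into a
-- k-th power; this regroups them.
actᵏ-comm : ∀ k p q F → actᵏ k p (act q F) ≐ act q (actᵏ k p F)
actᵏ-comm zero    p q F r w = refl
actᵏ-comm (suc k) p q F r w = trans (act-cong p (actᵏ-comm k p q F) r w) (act-comm p q (actᵏ k p F) r w)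

apply-blocks : ∀ m n k F → apply (blocks m n k) F
  ≐ actᵏ k (Laurent.cs (poch -qz m)) (actᵏ k (Laurent.cs (poch -z⁻¹ n)) F)
apply-blocks m n zero    F r w = refl
apply-blocks m n (suc k) F r w = trans (apply-left-sites m 0 n (right-sites n 0 m (blocks m n k)) F r w)
  (trans (act-cong B (apply-right-sites n m (blocks m n k) F) r w)
    (trans (act-comm B A (apply (blocks m n k) F) r w)
      (act-cong A (λ r w → trans (act-cong B (apply-blocks m n k F) r w)
                             (sym (actᵏ-comm k A B (actᵏ k B F) r w))) r w)))
  where
  A = Laurent.cs (poch -qz m)
  B = Laurent.cs (poch -z⁻¹ n)

-- The position of z⁰ in the coefficient list, hence the number of ones.
z-degree : ℕ → ℕ → ℕ → ℕ
z-degree m n k = Laurent.low ((poch -qz m ^L k) ⊗ (poch -z⁻¹ n ^L k))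

coeff-gaussC : ∀ m n k w →
  coeff (gaussC m n k) w ≡ + length (states (blocks m n k) (z-degree m n k) w)
coeff-gaussC m n k w = trans (sym (act-δ₀ (mulL' A B) R w))
  (trans (act-mulL' A B δ₀ R w)
    (trans (act-^L k (poch -qz m) (act B δ₀) R w)
      (trans (actᵏ-cong k (act-^L k (poch -z⁻¹ n) δ₀) R w)
        (trans (sym (apply-blocks m n k δ₀ R w)) (apply-δ₀ (blocks m n k) R w)))))
  where
  R = z-degree m n k
  A = Laurent.cs (poch -qz m ^L k)
  B = Laurent.cs (poch -z⁻¹ n ^L k)
  actᵏ-cong : ∀ k {F G} → F ≐ G → actᵏ k (Laurent.cs (poch -qz m)) F ≐ actᵏ k (Laurent.cs (poch -qz m)) G
  actᵏ-cong zero    e = e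
  actᵏ-cong (suc k) e = act-cong (Laurent.cs (poch -qz m)) (actᵏ-cong k e)

-- Location of the peak

Threshold : ℤ → ℕ → Set
Threshold c t = (∀ i → i ℕ.< t → 0ℤ < c - + 2 * + i) × (∀ i → t ℕ.≤ i → c - + 2 * + suc i < 0ℤ)

beyond : ∀ {c} i → c < + 2 → c - + 2 * + suc i < 0ℤ
beyond {c} i c<2 = subst (_< 0ℤ) (sym (split c (+ i)))
  (+-mono-<-≤ (+-monoˡ-< (- + 2) c<2) (neg-mono-≤ (*-monoˡ-≤-nonNeg (+ 2) (+≤+ (ℕ.z≤n {i})))))
  where
  split : ∀ c i → c - + 2 * (+ 1 + i) ≡ (c - + 2) + - (+ 2 * i)
  split = solve-∀

-- The witness is the floor of c / 2, or 0 when c is negative, hence the recursion in steps of 2.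
threshold : ∀ c → ∃ (Threshold c)
threshold -[1+ c ] = 0 , (λ _ ()) , λ i _ → beyond { -[1+ c ]} i -<+
threshold (+ 0)    = 0 , (λ _ ()) , λ i _ → beyond i (+<+ ℕ.z<s)
threshold (+ 1)    = 0 , (λ _ ()) , λ i _ → beyond i (+<+ (ℕ.s<s ℕ.z<s))
threshold (+ suc (suc c)) with threshold (+ c)
... | t , below , above = suc t , below′ , above′
  where
  drop-two : ∀ c i → (+ 2 + c) - + 2 * (+ 1 + i) ≡ c - + 2 * i
  drop-two = solve-∀
  below′ : ∀ i → i ℕ.< suc t → 0ℤ < + suc (suc c) - + 2 * + i
  below′ zero    _   = +<+ ℕ.z<s
  below′ (suc i) i<t = subst (0ℤ <_) (sym (drop-two (+ c) (+ i))) (below i (ℕ.s<s⁻¹ i<t))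
  above′ : ∀ i → suc t ℕ.≤ i → + suc (suc c) - + 2 * + suc i < 0ℤ
  above′ (suc i) t≤i = subst (_< 0ℤ) (sym (drop-two (+ c) (+ suc i))) (above i (ℕ.s≤s⁻¹ t≤i))

theorem2p3 : (m n k : ℕ) → 1 ≤ k → Unimodal (gaussC m n k)
-- The peak must not exceed the degree. If the minimum is `deg`, the decreasing range is empty.
theorem2p3 m n k _ = t ℕ.⊓ deg , ℕ.m⊓n≤n t deg
  , (λ i i<t → subst₂ ℤ._≤_ (sym (coeff-gaussC m n k i)) (sym (coeff-gaussC m n k (suc i)))
      (+≤+ (states-increasing i (below i (ℕ.<-≤-trans i<t (ℕ.m⊓n≤m t deg))))))
  , (λ i t≤i i<deg → subst₂ ℤ._≤_ (sym (coeff-gaussC m n k (suc i))) (sym (coeff-gaussC m n k i))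
      (+≤+ (states-decreasing i (above i (case ℕ.⊓-sel t deg of λ
        { (inj₁ e) → subst (ℕ._≤ i) e t≤i
        ; (inj₂ e) → contradiction (subst (ℕ._≤ i) e t≤i) (ℕ.<⇒≱ i<deg) })))))
  where
  open Strings (blocks m n k) (blocks-graded m n k) (+ m - + n + + 1) (blocks-balanced m n k) (z-degree m n k)
  deg = degree (gaussC m n k)
  t = proj₁ (threshold center)
  below = proj₁ (proj₂ (threshold center))
  above = proj₂ (proj₂ (threshold center))
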